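{- Let $\gamma=z+wj\in\mathcal{L}$, with $z,w\in\mathbb{Z}[i]$, be a Lipschitz integer whose norm $\mathrm{N}(\gamma)$ is odd. Then the right ideal $i\gamma\mathcal{H}+\gamma\mathcal{H}$ of $\mathcal{H}$ is equal to $\mathcal{H}$ if and only if $z$ and $w$ are coprime in $\mathbb{Z}[i]$.
   Context: $\mathbb{H}$ is the real quaternion algebra with basis $1,i,j,k$ ($i^2=j^2=k^2=ijk=-1$), with conjugation $u\mapsto\bar u$ and norm $\mathrm{N}(u)=u\bar{u}$. $\mathcal{L}=\mathbb{Z}+\mathbb{Z}i+\mathbb{Z}j+\mathbb{Z}k$ is the ring of Lipschitz integers, and $\mathcal{H}=\mathcal{L}\cup(\omega+\mathcal{L})$, with $\omega=\frac12(1+i+j+k)$, is the ring of Hurwitz integers. $\mathbb{Z}[i]=\mathbb{Z}+\mathbb{Z}i\subset\mathcal{L}$ is the ring of Gaussian integers; every element of $\mathcal{L}$ is uniquely of the form $z+wj$ with $z,w\in\mathbb{Z}[i]$. -}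

module Defs where

open import Algebra.Bundles.Raw using (RawRing)
import Algebra.Definitions.RawSemiring as RawSemiringDefinitions
open import Data.Integer.Base as ℤ using (ℤ; 0ℤ; 1ℤ)
open import Data.Product.Base using (∃-syntax; _×_)
open import Data.Rational.Base as ℚ using (ℚ; 0ℚ; 1ℚ; ½; _/_)
open import Level using (0ℓ)
open import Relation.Binary.PropositionalEquality using (_≡_; refl)
open import Relation.Unary using (Pred; _∈_; _∪_)

-- The quaternion algebra.  Coefficients are taken in ℚ rather than in the reals:
-- ℍ is then the ℚ-subalgebra of the real quaternions with the same basis, and
-- it contains the Hurwitz integers, their products, conjugates and norms.

record ℍ : Set where
  constructor quat
  field
    re im-i im-j im-k : ℚ

infixl 6 _+_
infixl 7 _*_

_+_ : ℍ → ℍ → ℍ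
quat a b c d + quat a′ b′ c′ d′ =
  quat (a ℚ.+ a′) (b ℚ.+ b′) (c ℚ.+ c′) (d ℚ.+ d′)

_*_ : ℍ → ℍ → ℍ
quat a b c d * quat a′ b′ c′ d′ = quat
  (a ℚ.* a′ ℚ.- b ℚ.* b′ ℚ.- c ℚ.* c′ ℚ.- d ℚ.* d′)
  (a ℚ.* b′ ℚ.+ b ℚ.* a′ ℚ.+ c ℚ.* d′ ℚ.- d ℚ.* c′)
  (a ℚ.* c′ ℚ.- b ℚ.* d′ ℚ.+ c ℚ.* a′ ℚ.+ d ℚ.* b′)
  (a ℚ.* d′ ℚ.+ b ℚ.* c′ ℚ.- c ℚ.* b′ ℚ.+ d ℚ.* a′)

conj : ℍ → ℍ
conj (quat a b c d) = quat a (ℚ.- b) (ℚ.- c) (ℚ.- d)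

N : ℍ → ℍ
N u = u * conj u

fromℤ : ℤ → ℍ
fromℤ n = quat (n / 1) 0ℚ 0ℚ 0ℚ

i j k ω : ℍ
i = quat 0ℚ 1ℚ 0ℚ 0ℚ
j = quat 0ℚ 0ℚ 1ℚ 0ℚ
k = quat 0ℚ 0ℚ 0ℚ 1ℚ
ω = quat ½ ½ ½ ½

i²≡-1 : i * i ≡ fromℤ ℤ.-1ℤ
i²≡-1 = refl

j²≡-1 : j * j ≡ fromℤ ℤ.-1ℤ
j²≡-1 = refl

k²≡-1 : k * k ≡ fromℤ ℤ.-1ℤ
k²≡-1 = refl

ijk≡-1 : i * j * k ≡ fromℤ ℤ.-1ℤ
ijk≡-1 = refl

HasOddNorm : Pred ℍ 0ℓ
HasOddNorm u = ∃[ n ] N u ≡ fromℤ (ℤ.+ 2 ℤ.* n ℤ.+ 1ℤ)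

infixr 8 _+ₗ_
infixr 8 _*ₗ_
infixl 7 _+ₛ_

_+ₗ_ : ℍ → Pred ℍ 0ℓ → Pred ℍ 0ℓ
(u +ₗ P) x = ∃[ p ] p ∈ P × x ≡ u + p

_*ₗ_ : ℍ → Pred ℍ 0ℓ → Pred ℍ 0ℓ
(u *ₗ P) x = ∃[ p ] p ∈ P × x ≡ u * p

_+ₛ_ : Pred ℍ 0ℓ → Pred ℍ 0ℓ → Pred ℍ 0ℓ
(P +ₛ Q) x = ∃[ p ] ∃[ q ] p ∈ P × q ∈ Q × x ≡ p + q

𝓛 : Pred ℍ 0ℓ
𝓛 x = ∃[ a ] ∃[ b ] ∃[ c ] ∃[ d ]
  x ≡ fromℤ a + fromℤ b * i + fromℤ c * j + fromℤ d * k

𝓗 : Pred ℍ 0ℓ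
𝓗 = 𝓛 ∪ (ω +ₗ 𝓛)

record ℤ[i] : Set where
  constructor gauss
  field
    re im : ℤ

ℤ[i]-rawRing : RawRing 0ℓ 0ℓ
ℤ[i]-rawRing = record
  { Carrier = ℤ[i]
  ; _≈_     = _≡_
  ; _+_     = λ { (gauss a b) (gauss c d) → gauss (a ℤ.+ c) (b ℤ.+ d) }
  ; _*_     = λ { (gauss a b) (gauss c d) →
                  gauss (a ℤ.* c ℤ.- b ℤ.* d) (a ℤ.* d ℤ.+ b ℤ.* c) }
  ; -_      = λ { (gauss a b) → gauss (ℤ.- a) (ℤ.- b) }
  ; 0#      = gauss 0ℤ 0ℤ
  ; 1#      = gauss 1ℤ 0ℤ
  }

-- Coprime z w : every common divisor of z and w in ℤ[i] divides 1.
open RawSemiringDefinitions (RawRing.rawSemiring ℤ[i]-rawRing) public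
  using (Coprime)

-- The inclusion of ℤ[i] in ℍ.
ι : ℤ[i] → ℍ
ι (gauss a b) = fromℤ a + fromℤ b * i

{-# OPTIONS --safe #-}

-- Let 𝔞 be the ideal.  If d divides z and w then 𝔞 ⊆ d 𝓗, so 𝔞 = 𝓗 makes d invertible in 𝓗,
-- and its inverse, lying in ℚ(i), is a Gaussian integer.  Conversely, 2 z and 2 w j are
-- γ - (i γ) i and γ + (i γ) i, so 2 z and 2 w lie in 𝔞, and so does the odd number γ γ̄; a Bézout
-- identity for z and w then gives 2 ∈ 𝔞, hence 1 ∈ 𝔞.

module Submission where

open import Algebra.Bundles.Raw using (RawRing)
import Algebra.Definitions.RawMagma as RawMagmaDefinitions
open import Data.Fin.Base using (Fin; combine)
open import Data.Fin.Patterns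
open import Data.Integer.Base as ℤ using (ℤ; +_; 0ℤ; 1ℤ; ∣_∣)
import Data.Integer.DivMod as ℤ
import Data.Integer.Properties as ℤ
import Data.Integer.Solver as ℤ-Solver
open import Data.Integer.Tactic.RingSolver using (solve-∀)
open import Data.Nat.Base as ℕ using (ℕ; suc; NonZero)
open import Data.Nat.Induction using (<-wellFounded)
import Data.Nat.Properties as ℕ
import Data.Nat.Tactic.RingSolver as ℕ
open import Data.Product.Base using (∃-syntax; _×_; _,_; proj₁; proj₂)
open import Data.Rational.Base as ℚ using (ℚ; fromℚᵘ)
import Data.Rational.Properties as ℚ
open import Data.Rational.Unnormalised.Base as ℚᵘ using (mkℚᵘ; *≡*)
import Data.Rational.Unnormalised.Properties as ℚᵘ
open import Data.Sum.Base using (_⊎_; inj₁; inj₂)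
open import Data.Vec.Base using (Vec; []; _∷_; concat; map)
open import Defs
open import Function.Bundles using (_⇔_; mk⇔)
open import Induction.WellFounded using (Acc; acc)
open import Level using (0ℓ)
open import Relation.Binary.PropositionalEquality
  using (_≡_; refl; sym; trans; cong; cong₂; subst; subst₂; module ≡-Reasoning)
open import Relation.Nullary.Decidable.Core using (yes; no)
open import Relation.Unary using (Pred; _∈_; _≐_)

open ℤ-Solver.+-*-Solver using (Polynomial; var; con; _:+_; _:*_; _:-_; :-_; ⟦_⟧; ⟦_⟧↓; prove)
open RawRing ℤ[i]-rawRing using ()
  renaming (_+_ to _+ᵍ_; _*_ to _*ᵍ_; -_ to -ᵍ_; 0# to 0ᵍ; 1# to 1ᵍ)
open RawMagmaDefinitions (RawRing.*-rawMagma ℤ[i]-rawRing) using (_∣_; _,_)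

-- Bézout's identity in ℤ[i]

-- Valued in ℕ, so that it can serve as the measure of the Euclidean descent.
norm : ℤ[i] → ℕ
norm (gauss a b) = ∣ a ∣ ℕ.* ∣ a ∣ ℕ.+ ∣ b ∣ ℕ.* ∣ b ∣

∣a∣²≡a² : ∀ a → + (∣ a ∣ ℕ.* ∣ a ∣) ≡ a ℤ.* a
∣a∣²≡a² (+ n)      = ℤ.pos-* n n
∣a∣²≡a² ℤ.-[1+ n ] = refl

pos-norm : ∀ a b → + norm (gauss a b) ≡ a ℤ.* a ℤ.+ b ℤ.* b
pos-norm a b = trans (ℤ.pos-+ (∣ a ∣ ℕ.* ∣ a ∣) (∣ b ∣ ℕ.* ∣ b ∣))
                     (cong₂ ℤ._+_ (∣a∣²≡a² a) (∣a∣²≡a² b))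

norm≡0⇒≡0 : ∀ z → norm z ≡ 0 → z ≡ 0ᵍ
norm≡0⇒≡0 (gauss a b) eq = cong₂ gauss
  (square a (ℕ.m+n≡0⇒m≡0 _ eq)) (square b (ℕ.m+n≡0⇒n≡0 (∣ a ∣ ℕ.* ∣ a ∣) eq))
  where
  square : ∀ a → ∣ a ∣ ℕ.* ∣ a ∣ ≡ 0 → a ≡ 0ℤ
  square ℤ.+0 _ = refl

-- The floor of `x / n` if the remainder is at most half of `n`, and the next integer otherwise,
-- which leaves a remainder of size `n ∸ r`. The bound is doubled to avoid halves.
nearest : ∀ x n .{{_ : NonZero n}} → ∃[ q ] 2 ℕ.* ∣ x ℤ.- q ℤ.* + n ∣ ℕ.≤ n
nearest x n with 2 ℕ.* (x ℤ.%ℕ n) ℕ.≤? n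
... | yes 2r≤n = x ℤ./ℕ n , subst (λ r → 2 ℕ.* ∣ r ∣ ℕ.≤ n) (sym remainder) 2r≤n
  where
  lemma : ∀ r q n → r ℤ.+ q ℤ.* n ℤ.- q ℤ.* n ≡ r
  lemma = solve-∀
  remainder : x ℤ.- (x ℤ./ℕ n) ℤ.* + n ≡ + (x ℤ.%ℕ n)
  remainder = trans (cong (ℤ._- (x ℤ./ℕ n) ℤ.* + n) (ℤ.a≡a%ℕn+[a/ℕn]*n x n))
                    (lemma (+ (x ℤ.%ℕ n)) (x ℤ./ℕ n) (+ n))
... | no 2r≰n = 1ℤ ℤ.+ x ℤ./ℕ n , subst (λ r → 2 ℕ.* r ℕ.≤ n) (sym ∣remainder∣) 2[n∸r]≤n
  where
  r : ℕ
  r = x ℤ.%ℕ n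
  lemma : ∀ r q n → r ℤ.+ q ℤ.* n ℤ.- (1ℤ ℤ.+ q) ℤ.* n ≡ r ℤ.- n
  lemma = solve-∀
  ∣remainder∣ : ∣ x ℤ.- (1ℤ ℤ.+ x ℤ./ℕ n) ℤ.* + n ∣ ≡ n ℕ.∸ r
  ∣remainder∣ = begin
    ∣ x ℤ.- (1ℤ ℤ.+ x ℤ./ℕ n) ℤ.* + n ∣
      ≡⟨ cong (λ y → ∣ y ℤ.- (1ℤ ℤ.+ x ℤ./ℕ n) ℤ.* + n ∣) (ℤ.a≡a%ℕn+[a/ℕn]*n x n) ⟩
    ∣ + r ℤ.+ (x ℤ./ℕ n) ℤ.* + n ℤ.- (1ℤ ℤ.+ x ℤ./ℕ n) ℤ.* + n ∣
      ≡⟨ cong ∣_∣ (lemma (+ r) (x ℤ./ℕ n) (+ n)) ⟩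
    ∣ + r ℤ.- + n ∣  ≡⟨ cong ∣_∣ (ℤ.m-n≡m⊖n r n) ⟩
    ∣ r ℤ.⊖ n ∣      ≡⟨ ℤ.∣⊖∣-≤ (ℕ.<⇒≤ (ℤ.n%ℕd<d x n)) ⟩
    n ℕ.∸ r          ∎
    where open ≡-Reasoning
  2[n∸r]≤n : 2 ℕ.* (n ℕ.∸ r) ℕ.≤ n
  2[n∸r]≤n = begin
    2 ℕ.* (n ℕ.∸ r)        ≡⟨ ℕ.*-distribˡ-∸ 2 n r ⟩
    2 ℕ.* n ℕ.∸ 2 ℕ.* r    ≤⟨ ℕ.∸-monoʳ-≤ (2 ℕ.* n) (ℕ.<⇒≤ (ℕ.≰⇒> 2r≰n)) ⟩
    2 ℕ.* n ℕ.∸ n          ≡⟨ cong (λ m → n ℕ.+ m ℕ.∸ n) (ℕ.+-identityʳ n) ⟩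
    n ℕ.+ n ℕ.∸ n          ≡⟨ ℕ.m+n∸n≡m n n ⟩
    n                      ∎
    where open ℕ.≤-Reasoning

-- Both coordinates are at most n/2 in size, so the sum of their squares is at most n²/2. Doubling
-- once more turns the left side into the squares of `2 ∣x∣` and `2 ∣y∣`.
2norm≤n² : ∀ x y n → 2 ℕ.* ∣ x ∣ ℕ.≤ n → 2 ℕ.* ∣ y ∣ ℕ.≤ n →
           2 ℕ.* norm (gauss x y) ℕ.≤ n ℕ.* n
2norm≤n² x y n 2∣x∣≤n 2∣y∣≤n = ℕ.*-cancelˡ-≤ 2 (begin
  2 ℕ.* (2 ℕ.* norm (gauss x y))  ≡⟨ lemma ∣ x ∣ ∣ y ∣ ⟩
  2 ℕ.* ∣ x ∣ ℕ.* (2 ℕ.* ∣ x ∣) ℕ.+ 2 ℕ.* ∣ y ∣ ℕ.* (2 ℕ.* ∣ y ∣)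
    ≤⟨ ℕ.+-mono-≤ (ℕ.*-mono-≤ 2∣x∣≤n 2∣x∣≤n) (ℕ.*-mono-≤ 2∣y∣≤n 2∣y∣≤n) ⟩
  n ℕ.* n ℕ.+ n ℕ.* n             ≡⟨ cong (n ℕ.* n ℕ.+_) (sym (ℕ.+-identityʳ (n ℕ.* n))) ⟩
  2 ℕ.* (n ℕ.* n)                 ∎)
  where
  open ℕ.≤-Reasoning
  lemma : ∀ x y → 2 ℕ.* (2 ℕ.* (x ℕ.* x ℕ.+ y ℕ.* y)) ≡
                  2 ℕ.* x ℕ.* (2 ℕ.* x) ℕ.+ 2 ℕ.* y ℕ.* (2 ℕ.* y)
  lemma = ℕ.solve-∀

2m≤n⇒m<n : ∀ m n .{{_ : NonZero n}} → 2 ℕ.* m ℕ.≤ n → m ℕ.< n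
2m≤n⇒m<n 0       (suc n) _    = ℕ.z<s
2m≤n⇒m<n (suc m) n       2m≤n = ℕ.<-≤-trans (ℕ.m<m+n (suc m) ℕ.z<s) 2m≤n

-- The quotient is z w̄ / N(w) with both coordinates rounded to a nearest integer.
division : ∀ z w .{{_ : NonZero (norm w)}} →
           ∃[ q ] norm (z +ᵍ -ᵍ (q *ᵍ w)) ℕ.< norm w
division (gauss a b) (gauss c d) = gauss q₁ q₂ , 2m≤n⇒m<n (norm r) n (ℕ.*-cancelʳ-≤ _ _ n (begin
  2 ℕ.* norm r ℕ.* n      ≡⟨ ℕ.*-assoc 2 (norm r) n ⟩
  2 ℕ.* (norm r ℕ.* n)    ≡⟨ cong (2 ℕ.*_) (ℤ.+-injective norm-r*n) ⟩
  2 ℕ.* norm (gauss x y)  ≤⟨ 2norm≤n² x y n (proj₂ (nearest X n)) (proj₂ (nearest Y n)) ⟩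
  n ℕ.* n                 ∎))
  where
  open ℕ.≤-Reasoning
  n : ℕ
  n = norm (gauss c d)
  X Y q₁ q₂ x y : ℤ
  X = a ℤ.* c ℤ.+ b ℤ.* d
  Y = b ℤ.* c ℤ.- a ℤ.* d
  q₁ = proj₁ (nearest X n)
  q₂ = proj₁ (nearest Y n)
  x = X ℤ.- q₁ ℤ.* + n
  y = Y ℤ.- q₂ ℤ.* + n
  r : ℤ[i]
  r = gauss a b +ᵍ -ᵍ (gauss q₁ q₂ *ᵍ gauss c d)
  -- Multiplicativity of the norm, N(r) N(w) = N(r w̄), where r w̄ = z w̄ - q N(w) has coordinates
  -- `x` and `y`.
  lemma : ∀ a b c d q₁ q₂ →
    let s = a ℤ.+ ℤ.- (q₁ ℤ.* c ℤ.- q₂ ℤ.* d)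
        t = b ℤ.+ ℤ.- (q₁ ℤ.* d ℤ.+ q₂ ℤ.* c)
        n = c ℤ.* c ℤ.+ d ℤ.* d
        x = a ℤ.* c ℤ.+ b ℤ.* d ℤ.- q₁ ℤ.* n
        y = b ℤ.* c ℤ.- a ℤ.* d ℤ.- q₂ ℤ.* n
    in (s ℤ.* s ℤ.+ t ℤ.* t) ℤ.* n ≡ x ℤ.* x ℤ.+ y ℤ.* y
  lemma = solve-∀
  norm-r*n : + (norm r ℕ.* n) ≡ + norm (gauss x y)
  norm-r*n = ≡.begin
    + (norm r ℕ.* n)     ≡.≡⟨ ℤ.pos-* (norm r) n ⟩
    + norm r ℤ.* + n     ≡.≡⟨ cong₂ ℤ._*_ (pos-norm (ℤ[i].re r) (ℤ[i].im r)) (pos-norm c d) ⟩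
    (ℤ[i].re r ℤ.* ℤ[i].re r ℤ.+ ℤ[i].im r ℤ.* ℤ[i].im r) ℤ.* (c ℤ.* c ℤ.+ d ℤ.* d)
      ≡.≡⟨ lemma a b c d q₁ q₂ ⟩
    _ ≡.≡⟨ cong (λ m → (X ℤ.- q₁ ℤ.* m) ℤ.* (X ℤ.- q₁ ℤ.* m) ℤ.+ (Y ℤ.- q₂ ℤ.* m) ℤ.* (Y ℤ.- q₂ ℤ.* m))
               (sym (pos-norm c d)) ⟩
    x ℤ.* x ℤ.+ y ℤ.* y  ≡.≡⟨ sym (pos-norm x y) ⟩
    + norm (gauss x y)   ≡.∎
    where module ≡ = ≡-Reasoning

-- Formal Gaussian integers for the ring solver

Polynomial² : ℕ → Set
Polynomial² n = Polynomial n × Polynomial n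

infixl 6 _:+ᵍ_
infixl 7 _:*ᵍ_
infix  8 :-ᵍ_

_:+ᵍ_ _:*ᵍ_ : ∀ {n} → Polynomial² n → Polynomial² n → Polynomial² n
(a , b) :+ᵍ (c , d) = a :+ c , b :+ d
(a , b) :*ᵍ (c , d) = a :* c :- b :* d , a :* d :+ b :* c

:-ᵍ_ : ∀ {n} → Polynomial² n → Polynomial² n
:-ᵍ (a , b) = :- a , :- b

gauss-unknown : ∀ {m} → Fin m → Polynomial² (m ℕ.* 2)
gauss-unknown x = var (combine x 0F) , var (combine x 1F)

gauss-coordinates : ∀ {m} → Vec ℤ[i] m → Vec ℤ (m ℕ.* 2)
gauss-coordinates zs = concat (map (λ { (gauss a b) → a ∷ b ∷ [] }) zs)

-- An identity in ℤ[i] is one polynomial identity over ℤ for each coordinate. `F` and `G` are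
-- written with formal Gaussian unknowns, each standing for two integer variables, and `refl`
-- compares the normal forms.
gauss-identity : ∀ {m} (zs : Vec ℤ[i] m)
  (F G : (Fin m → Polynomial² (m ℕ.* 2)) → Polynomial² (m ℕ.* 2)) →
  let ρ = gauss-coordinates zs
      f = F gauss-unknown; g = G gauss-unknown in
  ⟦ proj₁ f ⟧↓ ρ ≡ ⟦ proj₁ g ⟧↓ ρ → ⟦ proj₂ f ⟧↓ ρ ≡ ⟦ proj₂ g ⟧↓ ρ →
  gauss (⟦ proj₁ f ⟧ ρ) (⟦ proj₂ f ⟧ ρ) ≡ gauss (⟦ proj₁ g ⟧ ρ) (⟦ proj₂ g ⟧ ρ)
gauss-identity zs F G re≡ im≡ = cong₂ gauss
  (prove ρ (proj₁ f) (proj₁ g) re≡) (prove ρ (proj₂ f) (proj₂ g) im≡)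
  where ρ = gauss-coordinates zs; f = F gauss-unknown; g = G gauss-unknown

-- Euclid's algorithm

∣-remainder : ∀ {d} z q w → d ∣ w → d ∣ z +ᵍ -ᵍ (q *ᵍ w) → d ∣ z
∣-remainder {d} z q w (w′ , refl) (r′ , r′*d≡r) = q *ᵍ w′ +ᵍ r′ , (begin
  (q *ᵍ w′ +ᵍ r′) *ᵍ d
    ≡⟨ gauss-identity (q ∷ w′ ∷ r′ ∷ d ∷ [])
         (λ x → (x 0F :*ᵍ x 1F :+ᵍ x 2F) :*ᵍ x 3F)
         (λ x → x 0F :*ᵍ (x 1F :*ᵍ x 3F) :+ᵍ x 2F :*ᵍ x 3F) refl refl ⟩
  q *ᵍ w +ᵍ r′ *ᵍ d  ≡⟨ cong (q *ᵍ w +ᵍ_) r′*d≡r ⟩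
  q *ᵍ w +ᵍ (z +ᵍ -ᵍ (q *ᵍ w))
    ≡⟨ gauss-identity (q ∷ w ∷ z ∷ [])
         (λ x → x 0F :*ᵍ x 1F :+ᵍ (x 2F :+ᵍ :-ᵍ (x 0F :*ᵍ x 1F))) (λ x → x 2F) refl refl ⟩
  z                  ∎)
  where open ≡-Reasoning

-- Descent from `(z , w)` to `(w , r)`, where `r` is the remainder of `z` modulo `w`; by
-- `∣-remainder` the new pair is again coprime.
bezout : ∀ z w → Acc ℕ._<_ (norm w) → Coprime z w → ∃[ a ] ∃[ b ] a *ᵍ z +ᵍ b *ᵍ w ≡ 1ᵍ
bezout z w (acc rs) coprime with norm w ℕ.≟ 0
-- Here `w` is zero, so `z` is itself a common divisor, and coprimality supplies its inverse.
... | yes norm≡0 with coprime {z} (1ᵍ , *ᵍ-identityˡ z) (0ᵍ , trans (*ᵍ-zeroˡ z) (sym (norm≡0⇒≡0 w norm≡0)))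
  where
  *ᵍ-identityˡ : ∀ z → 1ᵍ *ᵍ z ≡ z
  *ᵍ-identityˡ z = gauss-identity (z ∷ []) (λ x → (con 1ℤ , con 0ℤ) :*ᵍ x 0F) (λ x → x 0F) refl refl
  *ᵍ-zeroˡ : ∀ z → 0ᵍ *ᵍ z ≡ 0ᵍ
  *ᵍ-zeroˡ z = gauss-identity (z ∷ []) (λ x → (con 0ℤ , con 0ℤ) :*ᵍ x 0F) (λ x → con 0ℤ , con 0ℤ) refl refl
... | a , az≡1 = a , 0ᵍ , trans
  (gauss-identity (a ∷ z ∷ w ∷ [])
    (λ x → x 0F :*ᵍ x 1F :+ᵍ (con 0ℤ , con 0ℤ) :*ᵍ x 2F) (λ x → x 0F :*ᵍ x 1F) refl refl)
  az≡1
bezout z w (acc rs) coprime | no norm≢0 =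
  let instance _ = ℕ.≢-nonZero norm≢0
      q , r<w = division z w
      r = z +ᵍ -ᵍ (q *ᵍ w)
      a , b , aw+br≡1 = bezout w r (rs r<w) λ d∣w d∣r → coprime (∣-remainder z q w d∣w d∣r) d∣w
  -- Substituting r = z - q w into a w + b r = 1 gives b z + (a - b q) w = 1.
  in b , a +ᵍ -ᵍ (b *ᵍ q) , trans
    (gauss-identity (a ∷ b ∷ q ∷ z ∷ w ∷ [])
      (λ x → x 1F :*ᵍ x 3F :+ᵍ (x 0F :+ᵍ :-ᵍ (x 1F :*ᵍ x 2F)) :*ᵍ x 4F)
      (λ x → x 0F :*ᵍ x 4F :+ᵍ x 1F :*ᵍ (x 3F :+ᵍ :-ᵍ (x 2F :*ᵍ x 4F))) refl refl)
    aw+br≡1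

-- Fractions with a fixed denominator

-- The rational number a / (m + 1).  Its normal form never matters, so it is kept opaque.
opaque
  frac : ℕ → ℤ → ℚ
  frac m a = fromℚᵘ (mkℚᵘ a m)

fromℚᵘ-homo-+ : ∀ p q → fromℚᵘ p ℚ.+ fromℚᵘ q ≡ fromℚᵘ (p ℚᵘ.+ q)
fromℚᵘ-homo-+ p q = ℚ.toℚᵘ-injective (ℚᵘ.≃-trans (ℚ.toℚᵘ-homo-+ (fromℚᵘ p) (fromℚᵘ q))
  (ℚᵘ.≃-trans (ℚᵘ.+-cong (ℚ.toℚᵘ-fromℚᵘ p) (ℚ.toℚᵘ-fromℚᵘ q))
              (ℚᵘ.≃-sym (ℚ.toℚᵘ-fromℚᵘ (p ℚᵘ.+ q)))))

fromℚᵘ-homo-* : ∀ p q → fromℚᵘ p ℚ.* fromℚᵘ q ≡ fromℚᵘ (p ℚᵘ.* q)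
fromℚᵘ-homo-* p q = ℚ.toℚᵘ-injective (ℚᵘ.≃-trans (ℚ.toℚᵘ-homo-* (fromℚᵘ p) (fromℚᵘ q))
  (ℚᵘ.≃-trans (ℚᵘ.*-cong (ℚ.toℚᵘ-fromℚᵘ p) (ℚ.toℚᵘ-fromℚᵘ q))
              (ℚᵘ.≃-sym (ℚ.toℚᵘ-fromℚᵘ (p ℚᵘ.* q)))))

fromℚᵘ-homo‿- : ∀ p → ℚ.- fromℚᵘ p ≡ fromℚᵘ (ℚᵘ.- p)
fromℚᵘ-homo‿- p = ℚ.toℚᵘ-injective (ℚᵘ.≃-trans (ℚ.toℚᵘ-homo‿- (fromℚᵘ p))
  (ℚᵘ.≃-trans (ℚᵘ.-‿cong (ℚ.toℚᵘ-fromℚᵘ p)) (ℚᵘ.≃-sym (ℚ.toℚᵘ-fromℚᵘ (ℚᵘ.- p)))))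

opaque
  unfolding frac

  frac-+ : ∀ m a b → frac m a ℚ.+ frac m b ≡ frac m (a ℤ.+ b)
  frac-+ m a b = trans (fromℚᵘ-homo-+ (mkℚᵘ a m) (mkℚᵘ b m))
    (ℚ.fromℚᵘ-cong {mkℚᵘ a m ℚᵘ.+ mkℚᵘ b m} {mkℚᵘ (a ℤ.+ b) m} (*≡* (lemma a b (+ suc m))))
    where
    lemma : ∀ a b n → (a ℤ.* n ℤ.+ b ℤ.* n) ℤ.* n ≡ (a ℤ.+ b) ℤ.* (n ℤ.* n)
    lemma = solve-∀

  -- With an integer as left factor the denominator does not change. This is enough, since the
  -- products that occur have a Lipschitz integer on the left.
  frac-* : ∀ m a b → frac 0 a ℚ.* frac m b ≡ frac m (a ℤ.* b)
  frac-* m a b = trans (fromℚᵘ-homo-* (mkℚᵘ a 0) (mkℚᵘ b m))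
    (ℚ.fromℚᵘ-cong {mkℚᵘ a 0 ℚᵘ.* mkℚᵘ b m} {mkℚᵘ (a ℤ.* b) m}
      (*≡* (cong (λ n → a ℤ.* b ℤ.* + n) (sym (ℕ.+-identityʳ (suc m))))))

  frac-neg : ∀ m a → ℚ.- frac m a ≡ frac m (ℤ.- a)
  frac-neg m a = fromℚᵘ-homo‿- (mkℚᵘ a m)

  frac-injective : ∀ m {a b} → frac m a ≡ frac m b → a ≡ b
  frac-injective m {a} {b} eq with ℚ.fromℚᵘ-injective {mkℚᵘ a m} {mkℚᵘ b m} eq
  ... | *≡* a*n≡b*n = ℤ.*-cancelʳ-≡ a b (+ suc m) a*n≡b*n

  halve : ∀ a → frac 1 (a ℤ.+ a) ≡ frac 0 a
  halve a = ℚ.fromℚᵘ-cong {mkℚᵘ (a ℤ.+ a) 1} {mkℚᵘ a 0} (*≡* (lemma a))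
    where
    lemma : ∀ a → (a ℤ.+ a) ℤ.* + 1 ≡ a ℤ.* + 2
    lemma = solve-∀

-- Quaternions over ℤ and over the polynomials of the ring solver

record Quat (A : Set) : Set where
  constructor quad
  field
    q₀ q₁ q₂ q₃ : A

open Quat

-- Over any raw ring, so that the same formulas give the integral quaternions and their formal
-- counterparts for the solver; evaluating the latter yields the former by computation.
module Hamilton (R : RawRing 0ℓ 0ℓ) where
  open RawRing R renaming (_+_ to _⊕_; _*_ to _⊗_; -_ to ⊖_)

  infixl 6 _∔_
  infixl 7 _∗_

  _∔_ : Quat Carrier → Quat Carrier → Quat Carrier
  quad a b c d ∔ quad a′ b′ c′ d′ = quad (a ⊕ a′) (b ⊕ b′) (c ⊕ c′) (d ⊕ d′)

  _∗_ : Quat Carrier → Quat Carrier → Quat Carrier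
  quad a b c d ∗ quad a′ b′ c′ d′ = quad
    (a ⊗ a′ ⊕ ⊖ (b ⊗ b′) ⊕ ⊖ (c ⊗ c′) ⊕ ⊖ (d ⊗ d′))
    (a ⊗ b′ ⊕ b ⊗ a′ ⊕ c ⊗ d′ ⊕ ⊖ (d ⊗ c′))
    (a ⊗ c′ ⊕ ⊖ (b ⊗ d′) ⊕ c ⊗ a′ ⊕ d ⊗ b′)
    (a ⊗ d′ ⊕ b ⊗ c′ ⊕ ⊖ (c ⊗ b′) ⊕ d ⊗ a′)

  conjugate : Quat Carrier → Quat Carrier
  conjugate (quad a b c d) = quad a (⊖ b) (⊖ c) (⊖ d)

  real : Carrier → Quat Carrier
  real a = quad a 0# 0# 0#

  -- `σ` is 2ω, the numerator of ω over the denominator 2.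
  I J K σ : Quat Carrier
  I = quad 0# 1# 0# 0#
  J = quad 0# 0# 1# 0#
  K = quad 0# 0# 0# 1#
  σ = quad 1# 1# 1# 1#

polynomials : ℕ → RawRing 0ℓ 0ℓ
polynomials n = record
  { Carrier = Polynomial n ; _≈_ = _≡_ ; _+_ = _:+_ ; _*_ = _:*_ ; -_ = :-_
  ; 0# = con 0ℤ ; 1# = con 1ℤ }

open Hamilton ℤ.+-*-rawRing
open module Formal {n} = Hamilton (polynomials n) using ()
  renaming (_∔_ to _:∔_; _∗_ to _:∗_; conjugate to :conjugate;
            real to :real; I to :I; J to :J; K to :K; σ to :σ)

quad-cong : ∀ {A : Set} {u v : Quat A} →
            q₀ u ≡ q₀ v → q₁ u ≡ q₁ v → q₂ u ≡ q₂ v → q₃ u ≡ q₃ v → u ≡ v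
quad-cong {u = quad _ _ _ _} {quad _ _ _ _} refl refl refl refl = refl

unknown : ∀ {m} → Fin m → Quat (Polynomial (m ℕ.* 4))
unknown x = quad (at 0F) (at 1F) (at 2F) (at 3F)
  where at = λ y → var (combine x y)

coordinates : ∀ {m} → Vec (Quat ℤ) m → Vec ℤ (m ℕ.* 4)
coordinates us = concat (map (λ { (quad a b c d) → a ∷ b ∷ c ∷ d ∷ [] }) us)

-- The analogue of `gauss-identity` with four coordinates for each unknown.
quat-identity : ∀ {m} (us : Vec (Quat ℤ) m)
  (F G : (Fin m → Quat (Polynomial (m ℕ.* 4))) → Quat (Polynomial (m ℕ.* 4))) →
  let ρ = coordinates us; f = F unknown; g = G unknown
      eval = λ e → ⟦ e ⟧ ρ; normal = λ e → ⟦ e ⟧↓ ρ in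
  normal (q₀ f) ≡ normal (q₀ g) → normal (q₁ f) ≡ normal (q₁ g) →
  normal (q₂ f) ≡ normal (q₂ g) → normal (q₃ f) ≡ normal (q₃ g) →
  quad (eval (q₀ f)) (eval (q₁ f)) (eval (q₂ f)) (eval (q₃ f)) ≡
  quad (eval (q₀ g)) (eval (q₁ g)) (eval (q₂ g)) (eval (q₃ g))
quat-identity us F G e₀ e₁ e₂ e₃ = quad-cong
  (prove ρ (q₀ f) (q₀ g) e₀) (prove ρ (q₁ f) (q₁ g) e₁)
  (prove ρ (q₂ f) (q₂ g) e₂) (prove ρ (q₃ f) (q₃ g) e₃)
  where ρ = coordinates us; f = F unknown; g = G unknown

∗-assoc : ∀ u v w → (u ∗ v) ∗ w ≡ u ∗ (v ∗ w)
∗-assoc u v w = quat-identity (u ∷ v ∷ w ∷ [])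
  (λ x → (x 0F :∗ x 1F) :∗ x 2F) (λ x → x 0F :∗ (x 1F :∗ x 2F)) refl refl refl refl

∗-distribʳ-∔ : ∀ u v w → (u ∔ v) ∗ w ≡ u ∗ w ∔ v ∗ w
∗-distribʳ-∔ u v w = quat-identity (u ∷ v ∷ w ∷ [])
  (λ x → (x 0F :∔ x 1F) :∗ x 2F) (λ x → x 0F :∗ x 2F :∔ x 1F :∗ x 2F) refl refl refl refl

-- Quaternions with integral coordinates over a common denominator

-- The denominator is `m + 1`: `over 0` presents the Lipschitz integers, and `over 1` the
-- half-integral quaternions, among which the Hurwitz integers lie.
over : ℕ → Quat ℤ → ℍ
over m (quad a b c d) = quat (frac m a) (frac m b) (frac m c) (frac m d)

quat-cong : ∀ {a b c d a′ b′ c′ d′} → a ≡ a′ → b ≡ b′ → c ≡ c′ → d ≡ d′ →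
            quat a b c d ≡ quat a′ b′ c′ d′
quat-cong refl refl refl refl = refl

over-∔ : ∀ m u v → over m u + over m v ≡ over m (u ∔ v)
over-∔ m (quad a b c d) (quad a′ b′ c′ d′) =
  quat-cong (frac-+ m a a′) (frac-+ m b b′) (frac-+ m c c′) (frac-+ m d d′)

over-∗ : ∀ m u v → over 0 u * over m v ≡ over m (u ∗ v)
over-∗ m (quad a b c d) (quad a′ b′ c′ d′) = quat-cong
  (a · a′ ⊟ b · b′ ⊟ c · c′ ⊟ d · d′)
  (a · b′ ⊞ b · a′ ⊞ c · d′ ⊟ d · c′)
  (a · c′ ⊟ b · d′ ⊞ c · a′ ⊞ d · b′)
  (a · d′ ⊞ b · c′ ⊟ c · b′ ⊞ d · a′)
  where
  infixl 6 _⊞_ _⊟_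
  infixl 7 _·_
  _·_ : ∀ a b → frac 0 a ℚ.* frac m b ≡ frac m (a ℤ.* b)
  _·_ = frac-* m
  _⊞_ : ∀ {p q a b} → p ≡ frac m a → q ≡ frac m b → p ℚ.+ q ≡ frac m (a ℤ.+ b)
  _⊞_ {a = a} {b} refl refl = frac-+ m a b
  _⊟_ : ∀ {p q a b} → p ≡ frac m a → q ≡ frac m b → p ℚ.- q ≡ frac m (a ℤ.- b)
  _⊟_ {a = a} {b} refl refl = trans (cong (frac m a ℚ.+_) (frac-neg m b)) (frac-+ m a (ℤ.- b))

conj-over : ∀ m u → conj (over m u) ≡ over m (conjugate u)
conj-over m (quad a b c d) = quat-cong refl (frac-neg m b) (frac-neg m c) (frac-neg m d)

over-injective : ∀ m {u v} → over m u ≡ over m v → u ≡ v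
over-injective m eq = quad-cong
  (frac-injective m (cong ℍ.re eq)) (frac-injective m (cong ℍ.im-i eq))
  (frac-injective m (cong ℍ.im-j eq)) (frac-injective m (cong ℍ.im-k eq))

over-1-double : ∀ u → over 1 (u ∔ u) ≡ over 0 u
over-1-double (quad a b c d) = quat-cong (halve a) (halve b) (halve c) (halve d)

opaque
  unfolding frac

  fromℤ≡over : ∀ a → fromℤ a ≡ over 0 (real a)
  fromℤ≡over a = refl

  i≡over : i ≡ over 0 I
  i≡over = refl

  j≡over : j ≡ over 0 J
  j≡over = refl

  k≡over : k ≡ over 0 K
  k≡over = refl

  ω≡over : ω ≡ over 1 σ
  ω≡over = refl

-- The Hurwitz integers as halves of e (1 + i + j + k) + 2 l

hurwitz : ℤ → Quat ℤ → Quat ℤ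
hurwitz e l = real e ∗ σ ∔ (l ∔ l)

-- Since `e` may be any integer, not just 0 or 1, the closure properties are polynomial identities
-- without cases on parity.
IsHurwitz : Quat ℤ → Set
IsHurwitz v = ∃[ e ] ∃[ l ] v ≡ hurwitz e l

hurwitz-∔ : ∀ {u v} → IsHurwitz u → IsHurwitz v → IsHurwitz (u ∔ v)
hurwitz-∔ (e , l , refl) (e′ , l′ , refl) = e ℤ.+ e′ , l ∔ l′ ,
  quat-identity (real e ∷ l ∷ real e′ ∷ l′ ∷ [])
    (λ x → (:real (q₀ (x 0F)) :∗ :σ :∔ (x 1F :∔ x 1F)) :∔ (:real (q₀ (x 2F)) :∗ :σ :∔ (x 3F :∔ x 3F)))
    (λ x → :real (q₀ (x 0F) :+ q₀ (x 2F)) :∗ :σ :∔ ((x 1F :∔ x 3F) :∔ (x 1F :∔ x 3F)))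
    refl refl refl refl

-- (a + b i + c j + d k)(1 + i + j + k)
--   = (a - b - c - d)(1 + i + j + k) + 2 ((b + c) i + (c + d) j + (b + d) k).
hurwitz-∗ : ∀ u {v} → IsHurwitz v → IsHurwitz (u ∗ v)
hurwitz-∗ u@(quad a b c d) (e , l , refl) =
  e ℤ.* (a ℤ.- b ℤ.- c ℤ.- d) , real e ∗ quad 0ℤ (b ℤ.+ c) (c ℤ.+ d) (b ℤ.+ d) ∔ u ∗ l ,
  quat-identity (u ∷ real e ∷ l ∷ [])
    (λ x → x 0F :∗ (:real (q₀ (x 1F)) :∗ :σ :∔ (x 2F :∔ x 2F)))
    (λ x → let quad a b c d = x 0F
               y = :real (q₀ (x 1F)) :∗ quad (con 0ℤ) (b :+ c) (c :+ d) (b :+ d) :∔ x 0F :∗ x 2F in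
      :real (q₀ (x 1F) :* (a :- b :- c :- d)) :∗ :σ :∔ (y :∔ y))
    refl refl refl refl

-- Passing between 𝓛, 𝓗 and integral coordinates

lipschitz-expansion : ∀ a b c d →
  fromℤ a + fromℤ b * i + fromℤ c * j + fromℤ d * k ≡ over 0 (quad a b c d)
lipschitz-expansion a b c d = begin
  fromℤ a + fromℤ b * i + fromℤ c * j + fromℤ d * k
    ≡⟨ cong₂ _+_ (cong₂ _+_ (cong₂ _+_ (fromℤ≡over a) (term b I i≡over)) (term c J j≡over))
                 (term d K k≡over) ⟩
  over 0 (real a) + over 0 (real b ∗ I) + over 0 (real c ∗ J) + over 0 (real d ∗ K)
    ≡⟨ cong (λ u → u + over 0 (real c ∗ J) + over 0 (real d ∗ K)) (over-∔ 0 (real a) (real b ∗ I)) ⟩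
  over 0 (real a ∔ real b ∗ I) + over 0 (real c ∗ J) + over 0 (real d ∗ K)
    ≡⟨ cong (_+ over 0 (real d ∗ K)) (over-∔ 0 (real a ∔ real b ∗ I) (real c ∗ J)) ⟩
  over 0 (real a ∔ real b ∗ I ∔ real c ∗ J) + over 0 (real d ∗ K)
    ≡⟨ over-∔ 0 (real a ∔ real b ∗ I ∔ real c ∗ J) (real d ∗ K) ⟩
  over 0 (real a ∔ real b ∗ I ∔ real c ∗ J ∔ real d ∗ K)
    ≡⟨ cong (over 0) (quat-identity (quad a b c d ∷ [])
         (λ x → let quad a b c d = x 0F in
                :real a :∔ :real b :∗ :I :∔ :real c :∗ :J :∔ :real d :∗ :K)
         (λ x → x 0F) refl refl refl refl) ⟩
  over 0 (quad a b c d)  ∎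
  where
  open ≡-Reasoning
  term : ∀ a {x} u → x ≡ over 0 u → fromℤ a * x ≡ over 0 (real a ∗ u)
  term a u refl = trans (cong (_* over 0 u) (fromℤ≡over a)) (over-∗ 0 (real a) u)

over⇒𝓛 : ∀ u → over 0 u ∈ 𝓛
over⇒𝓛 (quad a b c d) = a , b , c , d , sym (lipschitz-expansion a b c d)

𝓛⇒over : ∀ {x} → x ∈ 𝓛 → ∃[ u ] x ≡ over 0 u
𝓛⇒over (a , b , c , d , x≡) = quad a b c d , trans x≡ (lipschitz-expansion a b c d)

-- Elements of 𝓛 get `e = 0`, and those of ω + 𝓛 get `e = 1`.
𝓗⇒over : ∀ {x} → x ∈ 𝓗 → ∃[ v ] IsHurwitz v × x ≡ over 1 v
𝓗⇒over (inj₁ x∈𝓛) =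
  let u , x≡u = 𝓛⇒over x∈𝓛
  in u ∔ u , (0ℤ , u , double u) , trans x≡u (sym (over-1-double u))
  where
  double : ∀ u → u ∔ u ≡ hurwitz 0ℤ u
  double u = quat-identity (u ∷ []) (λ x → x 0F :∔ x 0F)
    (λ x → :real (con 0ℤ) :∗ :σ :∔ (x 0F :∔ x 0F)) refl refl refl refl
𝓗⇒over (inj₂ (y , y∈𝓛 , x≡ω+y)) =
  let u , y≡u = 𝓛⇒over y∈𝓛
  in hurwitz 1ℤ u , (1ℤ , u , refl) , trans x≡ω+y
       (trans (cong₂ _+_ ω≡over (trans y≡u (sym (over-1-double u)))) (over-∔ 1 σ (u ∔ u)))

even-or-odd : ∀ e → ∃[ f ] (e ≡ f ℤ.+ f ⊎ e ≡ 1ℤ ℤ.+ (f ℤ.+ f))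
even-or-odd e with e ℤ.%ℕ 2 | ℤ.n%ℕd<d e 2 | ℤ.a≡a%ℕn+[a/ℕn]*n e 2
... | 0 | _ | e≡ = e ℤ./ℕ 2 , inj₁ (trans e≡ (lemma (e ℤ./ℕ 2)))
  where
  lemma : ∀ f → + 0 ℤ.+ f ℤ.* + 2 ≡ f ℤ.+ f
  lemma = solve-∀
... | 1 | _ | e≡ = e ℤ./ℕ 2 , inj₂ (trans e≡ (lemma (e ℤ./ℕ 2)))
  where
  lemma : ∀ f → + 1 ℤ.+ f ℤ.* + 2 ≡ 1ℤ ℤ.+ (f ℤ.+ f)
  lemma = solve-∀
... | suc (suc _) | ℕ.s≤s (ℕ.s≤s ()) | _

-- The parity of `e` selects the coset: with e = 2f or e = 2f + 1, the Lipschitz part is `f σ + l`.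
over⇒𝓗 : ∀ {v} → IsHurwitz v → over 1 v ∈ 𝓗
over⇒𝓗 (e , l , refl) with even-or-odd e
... | f , inj₁ refl = inj₁ (subst (_∈ 𝓛) eq (over⇒𝓛 u))
  where
  u = real f ∗ σ ∔ l
  eq : over 0 u ≡ over 1 (hurwitz (f ℤ.+ f) l)
  eq = trans (sym (over-1-double u)) (cong (over 1) (quat-identity (real f ∷ l ∷ [])
    (λ x → let u = :real (q₀ (x 0F)) :∗ :σ :∔ x 1F in u :∔ u)
    (λ x → let f = q₀ (x 0F) in :real (f :+ f) :∗ :σ :∔ (x 1F :∔ x 1F)) refl refl refl refl))
... | f , inj₂ refl = inj₂ (over 0 u , over⇒𝓛 u , eq)
  where
  u = real f ∗ σ ∔ l
  eq : over 1 (hurwitz (1ℤ ℤ.+ (f ℤ.+ f)) l) ≡ ω + over 0 u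
  eq = begin
    over 1 (hurwitz (1ℤ ℤ.+ (f ℤ.+ f)) l)
      ≡⟨ cong (over 1) (quat-identity (real f ∷ l ∷ [])
           (λ x → let f = q₀ (x 0F) in :real (con 1ℤ :+ (f :+ f)) :∗ :σ :∔ (x 1F :∔ x 1F))
           (λ x → let u = :real (q₀ (x 0F)) :∗ :σ :∔ x 1F in :σ :∔ (u :∔ u))
           refl refl refl refl) ⟩
    over 1 (σ ∔ (u ∔ u))       ≡⟨ over-∔ 1 σ (u ∔ u) ⟨
    over 1 σ + over 1 (u ∔ u)  ≡⟨ cong₂ _+_ (sym ω≡over) (over-1-double u) ⟩
    ω + over 0 u               ∎
    where open ≡-Reasoning

𝓗-+ : ∀ {x y} → x ∈ 𝓗 → y ∈ 𝓗 → x + y ∈ 𝓗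
𝓗-+ x∈𝓗 y∈𝓗 =
  let u , hu , x≡u = 𝓗⇒over x∈𝓗
      v , hv , y≡v = 𝓗⇒over y∈𝓗
  in subst (_∈ 𝓗) (sym (trans (cong₂ _+_ x≡u y≡v) (over-∔ 1 u v))) (over⇒𝓗 (hurwitz-∔ hu hv))

lipschitz-*-𝓗 : ∀ u {x} → x ∈ 𝓗 → over 0 u * x ∈ 𝓗
lipschitz-*-𝓗 u x∈𝓗 =
  let v , hv , x≡v = 𝓗⇒over x∈𝓗
  in subst (_∈ 𝓗) (sym (trans (cong (over 0 u *_) x≡v) (over-∗ 1 u v))) (over⇒𝓗 (hurwitz-∗ u hv))

-- The right ideal generated by i γ and γ

-- The coordinates of z + w j, because i j = k.
pair : ℤ[i] → ℤ[i] → Quat ℤ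
pair (gauss a b) (gauss c d) = quad a b c d

pair-expansion : ∀ z w → ι z + ι w * j ≡ over 0 (pair z w)
pair-expansion (gauss a b) (gauss c d) = begin
  fromℤ a + fromℤ b * i + (fromℤ c + fromℤ d * i) * j
    ≡⟨ cong₂ (λ x y → x + y * j) (complex a b) (complex c d) ⟩
  over 0 (real a ∔ real b ∗ I) + over 0 (real c ∔ real d ∗ I) * j
    ≡⟨ cong (λ x → over 0 (real a ∔ real b ∗ I) + x)
         (trans (cong (over 0 (real c ∔ real d ∗ I) *_) j≡over) (over-∗ 0 (real c ∔ real d ∗ I) J)) ⟩
  over 0 (real a ∔ real b ∗ I) + over 0 ((real c ∔ real d ∗ I) ∗ J)
    ≡⟨ over-∔ 0 (real a ∔ real b ∗ I) ((real c ∔ real d ∗ I) ∗ J) ⟩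
  over 0 (real a ∔ real b ∗ I ∔ (real c ∔ real d ∗ I) ∗ J)
    ≡⟨ cong (over 0) (quat-identity (quad a b c d ∷ [])
         (λ x → let quad a b c d = x 0F in
                :real a :∔ :real b :∗ :I :∔ (:real c :∔ :real d :∗ :I) :∗ :J)
         (λ x → x 0F) refl refl refl refl) ⟩
  over 0 (quad a b c d)  ∎
  where
  open ≡-Reasoning
  complex : ∀ a b → fromℤ a + fromℤ b * i ≡ over 0 (real a ∔ real b ∗ I)
  complex a b = trans
    (cong₂ _+_ (fromℤ≡over a) (trans (cong₂ _*_ (fromℤ≡over b) i≡over) (over-∗ 0 (real b) I)))
    (over-∔ 0 (real a) (real b ∗ I))

i*over : ∀ u → i * over 0 u ≡ over 0 (I ∗ u)
i*over u = trans (cong (_* over 0 u) i≡over) (over-∗ 0 I u)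

odd-norm : ∀ g → HasOddNorm (over 0 g) → ∃[ n ] g ∗ conjugate g ≡ real (+ 2 ℤ.* n ℤ.+ 1ℤ)
odd-norm g (n , N≡) = n , over-injective 0 (begin
  over 0 (g ∗ conjugate g)         ≡⟨ over-∗ 0 g (conjugate g) ⟨
  over 0 g * over 0 (conjugate g)  ≡⟨ cong (over 0 g *_) (conj-over 0 g) ⟨
  N (over 0 g)                     ≡⟨ N≡ ⟩
  fromℤ (+ 2 ℤ.* n ℤ.+ 1ℤ)         ≡⟨ fromℤ≡over (+ 2 ℤ.* n ℤ.+ 1ℤ) ⟩
  over 0 (real (+ 2 ℤ.* n ℤ.+ 1ℤ)) ∎)
  where open ≡-Reasoning

-- Moves the general element of the ideal to integral numerators over 2, so that membership becomes
-- an equation in `Quat ℤ`.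
over-ideal : ∀ g u v → i * over 0 g * over 1 u + over 0 g * over 1 v ≡ over 1 ((I ∗ g) ∗ u ∔ g ∗ v)
over-ideal g u v = begin
  i * over 0 g * over 1 u + over 0 g * over 1 v
    ≡⟨ cong (λ x → x * over 1 u + over 0 g * over 1 v) (i*over g) ⟩
  over 0 (I ∗ g) * over 1 u + over 0 g * over 1 v
    ≡⟨ cong₂ _+_ (over-∗ 1 (I ∗ g) u) (over-∗ 1 g v) ⟩
  over 1 ((I ∗ g) ∗ u) + over 1 (g ∗ v)  ≡⟨ over-∔ 1 ((I ∗ g) ∗ u) (g ∗ v) ⟩
  over 1 ((I ∗ g) ∗ u ∔ g ∗ v)           ∎
  where open ≡-Reasoning

-- The coordinates of 1 = (i γ) p + γ q come from γ γ̄ = 2 n + 1 together with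
--   2 z = γ - (i γ) i   and   2 w = - (γ j + (i γ) k),
-- which give 2 = 2 (z a + w b) as a combination of i γ and γ.
one∈ideal : ∀ z w a b n → let g = pair z w in
  a *ᵍ z +ᵍ b *ᵍ w ≡ 1ᵍ → g ∗ conjugate g ≡ real (+ 2 ℤ.* n ℤ.+ 1ℤ) →
  ∃[ p ] ∃[ q ] (I ∗ g) ∗ p ∔ g ∗ q ≡ real 1ℤ
one∈ideal z w a b n az+bw≡1 gḡ≡2n+1 =
  p , q , (begin
    (I ∗ g) ∗ p ∔ g ∗ q
      ≡⟨ quat-identity (g ∷ pair a b ∷ real n ∷ [])
           (λ x → let g = x 0F; quad a₁ a₂ b₁ b₂ = x 1F; n = q₀ (x 2F)
                      A = quad a₁ a₂ (con 0ℤ) (con 0ℤ); B = quad b₁ b₂ (con 0ℤ) (con 0ℤ) in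
             (:I :∗ g) :∗ (:real n :∗ (:I :∗ A :∔ :K :∗ B)) :∔
             g :∗ (:conjugate g :∔ :real (:- n) :∗ (A :∔ :I :∗ (:K :∗ B))))
           (λ x → let g = x 0F; quad z₁ z₂ w₁ w₂ = g; quad a₁ a₂ b₁ b₂ = x 1F; n = q₀ (x 2F)
                      re , im = (a₁ , a₂) :*ᵍ (z₁ , z₂) :+ᵍ (b₁ , b₂) :*ᵍ (w₁ , w₂) in
             g :∗ :conjugate g :∔ :real (:- (n :+ n)) :∗ quad re im (con 0ℤ) (con 0ℤ))
           refl refl refl refl ⟩
    g ∗ conjugate g ∔ real (ℤ.- (n ℤ.+ n)) ∗ pair (a *ᵍ z +ᵍ b *ᵍ w) 0ᵍ
      ≡⟨ cong₂ (λ x y → x ∔ real (ℤ.- (n ℤ.+ n)) ∗ pair y 0ᵍ) gḡ≡2n+1 az+bw≡1 ⟩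
    real (+ 2 ℤ.* n ℤ.+ 1ℤ) ∔ real (ℤ.- (n ℤ.+ n)) ∗ real 1ℤ
      ≡⟨ quat-identity (real n ∷ [])
           (λ x → let n = q₀ (x 0F) in
             :real (con (+ 2) :* n :+ con 1ℤ) :∔ :real (:- (n :+ n)) :∗ :real (con 1ℤ))
           (λ x → :real (con 1ℤ)) refl refl refl refl ⟩
    real 1ℤ ∎)
  where
  open ≡-Reasoning
  g p q : Quat ℤ
  g = pair z w
  -- Apart from γ̄, these are the coefficients of - 2 n (z a + w b) on i γ and γ. Since i k = - j,
  -- the term `I ∗ (K ∗ pair b 0ᵍ)` is - j b.
  p = real n ∗ (I ∗ pair a 0ᵍ ∔ K ∗ pair b 0ᵍ)
  q = conjugate g ∔ real (ℤ.- n) ∗ (pair a 0ᵍ ∔ I ∗ (K ∗ pair b 0ᵍ))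

-- Gaussian integers with a Hurwitz inverse

double-injective : ∀ {a b} → a ℤ.+ a ≡ b ℤ.+ b → a ≡ b
double-injective {a} {b} eq = ℤ.*-cancelˡ-≡ (+ 2) a b (trans (lemma a) (trans eq (sym (lemma b))))
  where
  lemma : ∀ a → + 2 ℤ.* a ≡ a ℤ.+ a
  lemma = solve-∀

-- With u = d v, this follows from u₀ v₂ - u₂ v₀ + u₃ v₁ - u₁ v₃ = 0.
gaussian-multiple≡2⇒q₂≡0 : ∀ d v → pair d 0ᵍ ∗ v ≡ real (+ 2) → q₂ v ≡ 0ℤ
gaussian-multiple≡2⇒q₂≡0 (gauss x y) v@(quad v₀ v₁ v₂ v₃) dv≡2 = double-injective (begin
  v₂ ℤ.+ v₂                      ≡⟨ at-2 v₀ v₁ v₂ v₃ ⟩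
  f (real (+ 2))                 ≡⟨ cong f dv≡2 ⟨
  f (pair (gauss x y) 0ᵍ ∗ v)    ≡⟨ at-dv x y v₀ v₁ v₂ v₃ ⟩
  0ℤ ℤ.+ 0ℤ                      ∎)
  where
  open ≡-Reasoning
  -- `f u` is minus the j-coordinate of u v̄. For u = d v this product is d N(v), which has no
  -- j-coordinate; for u = 2 the value is 2 v₂.
  f : Quat ℤ → ℤ
  f (quad u₀ u₁ u₂ u₃) = u₀ ℤ.* v₂ ℤ.- u₂ ℤ.* v₀ ℤ.+ u₃ ℤ.* v₁ ℤ.- u₁ ℤ.* v₃
  at-2 : ∀ v₀ v₁ v₂ v₃ →
    v₂ ℤ.+ v₂ ≡ + 2 ℤ.* v₂ ℤ.- 0ℤ ℤ.* v₀ ℤ.+ 0ℤ ℤ.* v₁ ℤ.- 0ℤ ℤ.* v₃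
  at-2 = solve-∀
  at-dv : ∀ x y v₀ v₁ v₂ v₃ →
    let u₀ = x ℤ.* v₀ ℤ.- y ℤ.* v₁ ℤ.- 0ℤ ℤ.* v₂ ℤ.- 0ℤ ℤ.* v₃
        u₁ = x ℤ.* v₁ ℤ.+ y ℤ.* v₀ ℤ.+ 0ℤ ℤ.* v₃ ℤ.- 0ℤ ℤ.* v₂
        u₂ = x ℤ.* v₂ ℤ.- y ℤ.* v₃ ℤ.+ 0ℤ ℤ.* v₀ ℤ.+ 0ℤ ℤ.* v₁
        u₃ = x ℤ.* v₃ ℤ.+ y ℤ.* v₂ ℤ.- 0ℤ ℤ.* v₁ ℤ.+ 0ℤ ℤ.* v₀
    in u₀ ℤ.* v₂ ℤ.- u₂ ℤ.* v₀ ℤ.+ u₃ ℤ.* v₁ ℤ.- u₁ ℤ.* v₃ ≡ 0ℤ ℤ.+ 0ℤ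
  at-dv = solve-∀

-- The j-coordinate v₂ = e + 2 l₂ of v vanishes, so e is even and v / 2 has integral coordinates.
hurwitz-inverse : ∀ d {v} → IsHurwitz v → pair d 0ᵍ ∗ v ≡ real (+ 2) → d ∣ 1ᵍ
hurwitz-inverse d@(gauss x y) {v} (e , l@(quad l₀ l₁ l₂ l₃) , refl) dv≡2 =
  -- As e = - 2 l₂, these are the first two coordinates of v / 2, the inverse of `d`.
  gauss (l₀ ℤ.- l₂) (l₁ ℤ.- l₂) ,
  cong₂ gauss (double-injective (cong q₀ 2u≡2)) (double-injective (cong q₁ 2u≡2))
  where
  open ≡-Reasoning
  -- `u` is d (l - l₂ σ). Since v = 2 (l - l₂ σ) + v₂ σ, the product d v differs from 2 u by v₂ d σ,
  -- which vanishes.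
  u : Quat ℤ
  u = let gauss re im = gauss (l₀ ℤ.- l₂) (l₁ ℤ.- l₂) *ᵍ d in
      quad re im (ℤ.- (y ℤ.* (l₃ ℤ.- l₂))) (x ℤ.* (l₃ ℤ.- l₂))
  2u≡2 : u ∔ u ≡ real (+ 2)
  2u≡2 = begin
    u ∔ u
      ≡⟨ quat-identity (u ∷ pair d 0ᵍ ∗ σ ∷ [])
           (λ x → x 0F :∔ x 0F) (λ x → (x 0F :∔ x 0F) :∔ :real (con 0ℤ) :∗ x 1F)
           refl refl refl refl ⟩
    (u ∔ u) ∔ real 0ℤ ∗ (pair d 0ᵍ ∗ σ)
      ≡⟨ cong (λ c → (u ∔ u) ∔ real c ∗ (pair d 0ᵍ ∗ σ)) (gaussian-multiple≡2⇒q₂≡0 d v dv≡2) ⟨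
    (u ∔ u) ∔ real (q₂ v) ∗ (pair d 0ᵍ ∗ σ)
      ≡⟨ quat-identity (pair d 0ᵍ ∷ real e ∷ l ∷ [])
           (λ X → let quad x y _ _ = X 0F; l = X 2F; quad l₀ l₁ l₂ l₃ = l
                      d = quad x y (con 0ℤ) (con 0ℤ)
                      v = :real (q₀ (X 1F)) :∗ :σ :∔ (l :∔ l)
                      re , im = (l₀ :- l₂ , l₁ :- l₂) :*ᵍ (x , y)
                      u = quad re im (:- (y :* (l₃ :- l₂))) (x :* (l₃ :- l₂)) in
             (u :∔ u) :∔ :real (q₂ v) :∗ (d :∗ :σ))
           (λ X → let quad x y _ _ = X 0F; l = X 2F in
             quad x y (con 0ℤ) (con 0ℤ) :∗ (:real (q₀ (X 1F)) :∗ :σ :∔ (l :∔ l)))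
           refl refl refl refl ⟩
    pair d 0ᵍ ∗ v  ≡⟨ dv≡2 ⟩
    real (+ 2)     ∎

-- As `d` commutes with i and with Gaussian integers, it factors out on the left, leaving a Hurwitz
-- numerator. The value is 2 rather than 1 because numerators are taken over 2.
common-divisor-∣1 : ∀ d z w {p q} → IsHurwitz p → IsHurwitz q →
  let g = pair (z *ᵍ d) (w *ᵍ d) in (I ∗ g) ∗ p ∔ g ∗ q ≡ real (+ 2) → d ∣ 1ᵍ
common-divisor-∣1 d z w {p} {q} hp hq ≡2 =
  hurwitz-inverse d (hurwitz-∔ (hurwitz-∗ (I ∗ g′) hp) (hurwitz-∗ g′ hq)) (trans
    (quat-identity (pair d 0ᵍ ∷ g′ ∷ p ∷ q ∷ [])
      (λ x → let quad d₀ d₁ _ _ = x 0F; g′ = x 1F in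
        quad d₀ d₁ (con 0ℤ) (con 0ℤ) :∗ ((:I :∗ g′) :∗ x 2F :∔ g′ :∗ x 3F))
      (λ x → let quad d₀ d₁ _ _ = x 0F; quad z₀ z₁ w₀ w₁ = x 1F
                 a , b = (z₀ , z₁) :*ᵍ (d₀ , d₁); c , e = (w₀ , w₁) :*ᵍ (d₀ , d₁)
                 g = quad a b c e in
        (:I :∗ g) :∗ x 2F :∔ g :∗ x 3F)
      refl refl refl refl)
    ≡2)
  where
  g′ : Quat ℤ
  g′ = pair z w

-- The equivalence for γ in integral coordinates

ideal-of-pair : ∀ z w → let γ = over 0 (pair z w) in
  HasOddNorm γ → ((i * γ) *ₗ 𝓗 +ₛ γ *ₗ 𝓗) ≐ 𝓗 ⇔ Coprime z w
ideal-of-pair z w odd = mk⇔ coprime (λ z⊥w → ideal⊆𝓗 , 𝓗⊆ideal z⊥w)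
  where
  open ≡-Reasoning
  g : Quat ℤ
  g = pair z w
  γ : ℍ
  γ = over 0 g
  ideal : Pred ℍ 0ℓ
  ideal = (i * γ) *ₗ 𝓗 +ₛ γ *ₗ 𝓗

  coprime : ideal ≐ 𝓗 → Coprime z w
  coprime (_ , 𝓗⊆ideal) {d} (z′ , z′*d≡z) (w′ , w′*d≡w) =
    -- Only the membership of 1 in the ideal is extracted from the equality.
    let x , y , (s , s∈𝓗 , x≡) , (t , t∈𝓗 , y≡) , 1≡x+y = 𝓗⊆ideal (inj₁ (over⇒𝓛 (real 1ℤ)))
        p , hp , s≡p = 𝓗⇒over s∈𝓗
        q , hq , t≡q = 𝓗⇒over t∈𝓗
    in common-divisor-∣1 d z′ w′ hp hq (subst₂ (λ z w → (I ∗ pair z w) ∗ p ∔ pair z w ∗ q ≡ real (+ 2))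
      (sym z′*d≡z) (sym w′*d≡w) (over-injective 1 (begin
        over 1 ((I ∗ g) ∗ p ∔ g ∗ q)     ≡⟨ over-ideal g p q ⟨
        i * γ * over 1 p + γ * over 1 q  ≡⟨ cong₂ (λ s t → i * γ * s + γ * t) s≡p t≡q ⟨
        i * γ * s + γ * t                ≡⟨ cong₂ _+_ x≡ y≡ ⟨
        x + y                            ≡⟨ 1≡x+y ⟨
        over 0 (real 1ℤ)                 ≡⟨ over-1-double (real 1ℤ) ⟨
        over 1 (real (+ 2))              ∎)))

  ideal⊆𝓗 : ∀ {x} → x ∈ ideal → x ∈ 𝓗
  ideal⊆𝓗 (_ , _ , (p , p∈𝓗 , refl) , (q , q∈𝓗 , refl) , refl) =
    𝓗-+ (subst (λ u → u * p ∈ 𝓗) (sym (i*over g)) (lipschitz-*-𝓗 (I ∗ g) p∈𝓗))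
        (lipschitz-*-𝓗 g q∈𝓗)

  𝓗⊆ideal : Coprime z w → ∀ {x} → x ∈ 𝓗 → x ∈ ideal
  𝓗⊆ideal z⊥w {x} x∈𝓗 =
    let a , b , az+bw≡1 = bezout z w (<-wellFounded (norm w)) z⊥w
        n , gḡ≡2n+1 = odd-norm g odd
        p , q , ≡1 = one∈ideal z w a b n az+bw≡1 gḡ≡2n+1
        v , hv , x≡v = 𝓗⇒over x∈𝓗
    -- The representation of 1 is multiplied by `v` on the right. As `p` and `q` have integral
    -- coordinates, `p ∗ v` and `q ∗ v` are again Hurwitz numerators.
    in i * γ * over 1 (p ∗ v) , γ * over 1 (q ∗ v) ,
       (over 1 (p ∗ v) , over⇒𝓗 (hurwitz-∗ p hv) , refl) ,
       (over 1 (q ∗ v) , over⇒𝓗 (hurwitz-∗ q hv) , refl) ,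
       trans x≡v (trans (cong (over 1) (expand p q v ≡1)) (sym (over-ideal g (p ∗ v) (q ∗ v))))
    where
    expand : ∀ p q v → (I ∗ g) ∗ p ∔ g ∗ q ≡ real 1ℤ → v ≡ (I ∗ g) ∗ (p ∗ v) ∔ g ∗ (q ∗ v)
    expand p q v ≡1 = begin
      v
        ≡⟨ quat-identity (v ∷ []) (λ x → x 0F) (λ x → :real (con 1ℤ) :∗ x 0F) refl refl refl refl ⟩
      real 1ℤ ∗ v                        ≡⟨ cong (_∗ v) ≡1 ⟨
      ((I ∗ g) ∗ p ∔ g ∗ q) ∗ v          ≡⟨ ∗-distribʳ-∔ ((I ∗ g) ∗ p) (g ∗ q) v ⟩
      ((I ∗ g) ∗ p) ∗ v ∔ (g ∗ q) ∗ v    ≡⟨ cong₂ _∔_ (∗-assoc (I ∗ g) p v) (∗-assoc g q v) ⟩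
      (I ∗ g) ∗ (p ∗ v) ∔ g ∗ (q ∗ v)    ∎

proposition4p4 : (γ : ℍ) (z w : ℤ[i]) →
    γ ∈ 𝓛 → γ ≡ ι z + ι w * j → HasOddNorm γ →
    ((i * γ) *ₗ 𝓗 +ₛ γ *ₗ 𝓗) ≐ 𝓗 ⇔ Coprime z w
proposition4p4 γ z w _ γ≡z+wj =
  subst (λ γ → HasOddNorm γ → ((i * γ) *ₗ 𝓗 +ₛ γ *ₗ 𝓗) ≐ 𝓗 ⇔ Coprime z w)
    (sym (trans γ≡z+wj (pair-expansion z w))) (ideal-of-pair z w)
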